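{- Let $a$ and $b$ be positive coprime integers with $2a \le b$. (1) If $ab$ is even, then for every integer $n \ge (a+b-1)(3a+b-1)$ there exists an $(a,b)$-necklace of length $n$. (2) If $ab$ is odd, then for every even integer $n \ge (a+b-2)(3a+b-2)/2$ there exists an $(a,b)$-necklace of length $n$.
   Context: For positive integers $a<b$ and $n \ge 3$, an $(a,b)$-necklace of length $n$ is a circular arrangement of the integers $0,1,\ldots,n-1$ (each used exactly once) such that any two adjacent entries (beads) have difference $\pm a$ or $\pm b$; the first and last entries count as adjacent. Equivalently, it is a Hamiltonian cycle in the graph $G_{a,b}(n)$ with vertex set $\{0,1,\ldots,n-1\}$ in which $x,y$ are adjacent if and only if $|x-y| \in \{a,b\}$. -}

module Defs where

open import Data.List.Base using (List; _∷_; _∷ʳ_; upTo)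
open import Data.List.Relation.Binary.Permutation.Propositional using (_↭_)
open import Data.List.Relation.Unary.Linked using (Linked)
open import Data.Nat.Base using (ℕ; _≤_; ∣_-_∣)
open import Data.Sum.Base using (_⊎_)
open import Relation.Binary.PropositionalEquality.Core using (_≡_)

Adjacent : ℕ → ℕ → ℕ → ℕ → Set
Adjacent a b x y = ∣ x - y ∣ ≡ a ⊎ ∣ x - y ∣ ≡ b

-- The circular arrangement is read off starting from an arbitrary bead.
-- Repeating that bead at the end makes `Linked` also require the last and
-- first beads to be adjacent. Without `3≤n`, a single adjacent pair would
-- count as a necklace of length 2.
record Necklace (a b n : ℕ) : Set where
  field
    3≤n       : 3 ≤ n
    first     : ℕ
    rest      : List ℕ
    eachOnce  : first ∷ rest ↭ upTo n
    adjacent  : Linked (Adjacent a b) (first ∷ (rest ∷ʳ first))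

{-# OPTIONS --safe #-}
module Submission where

-- Stepping by a modulo a + b is an (a,b)-necklace of length a + b. Replacing
-- its edges x → x + a for a ≤ x < 2a by x → x + b → x + b + a → x + a gives one
-- of length 3a + b. A necklace on the integers from m on is glued on top of one
-- of length m by exchanging the a-edges {t , t + a} and {t + b , t + b + a} for
-- two b-edges, where t + b = m + y for a fixed y. The lengths obtained this way
-- are the j (a + b) + k (3a + b), and a + b and 3a + b have gcd 1 or 2, so the
-- bounds on n are the Sylvester–Frobenius bound.

open import Defs
open import Data.List.Base using (List; []; _∷_; _++_; _∷ʳ_; [_]; reverse; map; length; upTo; applyUpTo)
open import Data.List.Membership.Propositional using (_∈_)
open import Data.List.Membership.Propositional.Properties
  using (∈-∃++; ∈-++⁻; ∈-++⁺ˡ; ∈-++⁺ʳ; ∈-upTo⁺; ∈-applyUpTo⁻)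
open import Data.List.Properties
  using (unfold-reverse; length-++-sucʳ; length-applyUpTo; ++-assoc; ++-identityʳ;
         map-upTo; map-++; map-∘; map-cong; upTo-∷ʳ)
open import Data.List.Relation.Binary.Permutation.Propositional
  using (_↭_; prep; ↭-refl; ↭-sym; ↭-trans; ↭-reflexive; module PermutationReasoning)
open import Data.List.Relation.Binary.Permutation.Propositional.Properties
  using (shift; ↭-reverse; ∈-resp-↭; ++⁺; ++⁺ˡ; ++⁺ʳ; map⁺; ++-comm)
open import Data.List.Relation.Unary.All using (lookup)
open import Data.List.Relation.Unary.AllPairs using (_∷_)
open import Data.List.Relation.Unary.Any using (here; there)
open import Data.List.Relation.Unary.Linked using (Linked; [-]; _∷_)
open import Data.List.Relation.Unary.Unique.Propositional using (Unique)
open import Data.List.Relation.Unary.Unique.Propositional.Properties using (applyUpTo⁺₁)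
open import Data.Nat
open import Data.Nat.Coprimality using (Coprime; coprime-divisor)
open import Data.Nat.Divisibility
open import Data.Nat.DivMod
open import Data.Nat.Primality using (prime[2]; euclidsLemma)
open import Data.Nat.Properties
open import Data.Nat.Tactic.RingSolver using (solve-∀)
open import Data.Product using (_×_; _,_; ∃; ∃₂; proj₂)
open import Data.Sum using (_⊎_; inj₁; inj₂)
open import Function using (_∘_; id)
open import Relation.Binary.Definitions using (tri<; tri≈; tri>)
open import Relation.Binary.PropositionalEquality hiding ([_])
open import Relation.Nullary using (¬_; yes; no; contradiction)

-- Residues and the two-coin Frobenius bound

unique-⊆⇒↭ : ∀ {A : Set} {xs ys : List A} → Unique xs → (∀ {x} → x ∈ xs → x ∈ ys) →
             length ys ≤ length xs → xs ↭ ys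
unique-⊆⇒↭ {xs = []} {[]} _ _ _ = ↭-refl
unique-⊆⇒↭ {xs = x ∷ xs} (x∉xs ∷ unique) xs⊆ys ys≤xs
  with as , bs , refl ← ∈-∃++ (xs⊆ys (here refl)) =
  ↭-trans (prep x (unique-⊆⇒↭ unique xs⊆as++bs shorter)) (↭-sym (shift x as bs))
  where
  xs⊆as++bs : ∀ {z} → z ∈ xs → z ∈ as ++ bs
  xs⊆as++bs z∈xs with ∈-++⁻ as (xs⊆ys (there z∈xs))
  ... | inj₁ z∈as         = ∈-++⁺ˡ z∈as
  ... | inj₂ (here refl)  = contradiction refl (lookup x∉xs z∈xs)
  ... | inj₂ (there z∈bs) = ∈-++⁺ʳ as z∈bs
  shorter : length (as ++ bs) ≤ length xs
  shorter = s≤s⁻¹ (subst (_≤ suc (length xs)) (length-++-sucʳ as x bs) ys≤xs)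

%-≡⇒∣ : ∀ m x n .{{_ : NonZero n}} → m % n ≡ (m + x) % n → n ∣ x
%-≡⇒∣ m x n eq = ∣m+n∣m⇒∣n (subst (n ∣_) (+-cancelˡ-≡ (m % n) _ _ same) (n∣m*n ((m + x) / n)))
                   (n∣m*n (m / n))
  where
  open ≡-Reasoning
  same : m % n + (m + x) / n * n ≡ m % n + (m / n * n + x)
  same = begin
    m % n + (m + x) / n * n       ≡⟨ cong (_+ (m + x) / n * n) eq ⟩
    (m + x) % n + (m + x) / n * n ≡⟨ m≡m%n+[m/n]*n (m + x) n ⟨
    m + x                         ≡⟨ cong (_+ x) (m≡m%n+[m/n]*n m n) ⟩
    m % n + m / n * n + x         ≡⟨ +-assoc (m % n) _ x ⟩
    m % n + (m / n * n + x)       ∎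

module _ (c s n : ℕ) .{{_ : NonZero n}} where

  residue : ℕ → ℕ
  residue k = (c + k * s) % n

  -- Two equal residues with `i < j < n` would make `n` divide `(j - i) * s`, hence the smaller
  -- positive number `j - i`. So the `n` residues are distinct and, by counting, exhaust `upTo n`.
  residues-↭ : Coprime n s → applyUpTo residue n ↭ upTo n
  residues-↭ coprime = unique-⊆⇒↭ (applyUpTo⁺₁ residue n distinct) bounded
    (≤-reflexive (trans (length-applyUpTo _ n) (sym (length-applyUpTo _ n))))
    where
    bounded : ∀ {x} → x ∈ applyUpTo residue n → x ∈ upTo n
    bounded x∈ with k , _ , refl ← ∈-applyUpTo⁻ residue x∈ = ∈-upTo⁺ (m%n<n (c + k * s) n)
    distinct : ∀ {i j} → i < j → j < n → residue i ≢ residue j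
    distinct {i} i<j j<n eq with d , refl ← m≤n⇒∃[o]m+o≡n i<j =
      >⇒∤ (≤-<-trans (s≤s (m≤n+m d i)) j<n) (coprime-divisor coprime n∣s*[1+d])
      where
      open ≡-Reasoning
      split : c + suc (i + d) * s ≡ c + i * s + s * suc d
      split = begin
        c + suc (i + d) * s       ≡⟨ cong (λ k → c + k * s) (+-suc i d) ⟨
        c + (i + suc d) * s       ≡⟨ cong (c +_) (*-distribʳ-+ s i (suc d)) ⟩
        c + (i * s + suc d * s)   ≡⟨ +-assoc c (i * s) _ ⟨
        c + i * s + suc d * s     ≡⟨ cong (c + i * s +_) (*-comm (suc d) s) ⟩
        c + i * s + s * suc d     ∎
      n∣s*[1+d] : n ∣ s * suc d
      n∣s*[1+d] = %-≡⇒∣ (c + i * s) (s * suc d) n (trans eq (cong (_% n) split))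

-- Take `y < p` with `y * q` congruent to `n` modulo `p`. If `y * q` exceeded `n`, it would do so by
-- at least `p`, giving `n ≤ (p - 1) * q - p`, which is one less than `(p - 1) * (q - 1)`.
frobenius : ∀ p q n .{{_ : NonZero p}} .{{_ : NonZero q}} → Coprime p q → (p ∸ 1) * (q ∸ 1) ≤ n →
            ∃₂ λ x y → n ≡ x * p + y * q
frobenius p@(suc p-1) q@(suc q-1) n coprime large
  with y , y<p , n%p≡ ← ∈-applyUpTo⁻ (residue 0 q p)
         (∈-resp-↭ (↭-sym (residues-↭ 0 q p coprime)) (∈-upTo⁺ (m%n<n n p)))
  with ≤-total (y * q) n
... | inj₁ yq≤n with d , refl ← m≤n⇒∃[o]m+o≡n yq≤n
                with divides x refl ← %-≡⇒∣ (y * q) d p (sym n%p≡) = x , y , +-comm (y * q) _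
... | inj₂ n≤yq with d , n+d≡yq ← m≤n⇒∃[o]m+o≡n n≤yq
                with %-≡⇒∣ n d p (trans n%p≡ (cong (_% p) (sym n+d≡yq)))
...   | divides zero    refl = 0 , y , trans (sym (+-identityʳ n)) n+d≡yq
...   | divides (suc x) refl = contradiction tooLarge (<-irrefl refl)
  where
  open ≤-Reasoning
  tooLarge : y * q < y * q
  tooLarge = begin-strict
    y * q                    ≤⟨ *-monoˡ-≤ q (s≤s⁻¹ y<p) ⟩
    p-1 * q                  ≡⟨ *-suc p-1 q-1 ⟩
    p-1 + p-1 * q-1          ≡⟨ +-comm p-1 _ ⟩
    p-1 * q-1 + p-1          <⟨ +-mono-≤-< large (n<1+n p-1) ⟩
    n + p                    ≤⟨ +-monoʳ-≤ n (m≤m+n p (x * p)) ⟩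
    n + suc x * p            ≡⟨ n+d≡yq ⟩
    y * q                    ∎

-- Walks and detours

-- Steps are directed: later instances of `R x y` record which successor `y` the vertex `x` has, not
-- only that the two are adjacent.
data Walk {A : Set} (R : A → A → Set) : A → A → List A → Set where
  done : ∀ {x} → Walk R x x (x ∷ [])
  step : ∀ {x y z xs} → R x y → Walk R y z xs → Walk R x z (x ∷ xs)

module _ {A : Set} {R : A → A → Set} where

  join : ∀ {x y z w xs ys} → Walk R x y xs → R y z → Walk R z w ys → Walk R x w (xs ++ ys)
  join done         r w′ = step r w′
  join (step r′ w)  r w′ = step r′ (join w r w′)

  reverseWalk : (∀ {x y} → R x y → R y x) → ∀ {x y xs} → Walk R x y xs → Walk R y x (reverse xs)
  reverseWalk R-sym done = done
  reverseWalk R-sym (step {x} {xs = xs} r w) =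
    subst (Walk R _ x) (sym (unfold-reverse x xs)) (join (reverseWalk R-sym w) (R-sym r) done)

  mapWalk : {B : Set} {S : B → B → Set} {f : A → B} → (∀ {x y} → R x y → S (f x) (f y)) →
            ∀ {x y xs} → Walk R x y xs → Walk S (f x) (f y) (map f xs)
  mapWalk f-step done       = done
  mapWalk f-step (step r w) = step (f-step r) (mapWalk f-step w)

  weaken : {S : A → A → Set} → (∀ {x y} → R x y → S x y) →
           ∀ {x y xs} → Walk R x y xs → Walk S x y xs
  weaken R⇒S done       = done
  weaken R⇒S (step r w) = step (R⇒S r) (weaken R⇒S w)

  splitWalk : ∀ {x y t xs} → Walk R x y xs → t ∈ xs → t ≢ y →
              ∃₂ λ as bs → ∃ λ s → xs ≡ as ++ bs × Walk R x t as × R t s × Walk R s y bs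
  splitWalk done       (here refl) t≢y = contradiction refl t≢y
  splitWalk (step r w) (here refl) t≢y = _ , _ , _ , refl , done , r , w
  splitWalk (step r w) (there t∈xs) t≢y
    with as , bs , s , refl , w₁ , r′ , w₂ ← splitWalk w t∈xs t≢y =
    _ ∷ as , bs , s , refl , step r w₁ , r′ , w₂

  walk-nonempty : ∀ {x y xs} → Walk R x y xs → ∃ λ ys → xs ≡ x ∷ ys
  walk-nonempty done       = _ , refl
  walk-nonempty (step _ _) = _ , refl

  walk⇒linked : ∀ {x y z xs} → Walk R x y xs → R y z → Linked R (xs ∷ʳ z)
  walk⇒linked done                      r = r ∷ [-]
  walk⇒linked (step r′ done)            r = r′ ∷ r ∷ [-]
  walk⇒linked (step r′ w@(step _ _))    r = r′ ∷ walk⇒linked w r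

  iterateWalk : (f : ℕ → A) → (∀ k → R (f k) (f (suc k))) →
                ∀ n → Walk R (f 0) (f n) (applyUpTo f (suc n))
  iterateWalk f r zero    = done
  iterateWalk f r (suc n) = step (r 0) (iterateWalk (f ∘ suc) (r ∘ suc) n)

module _ {A : Set} {R S : A → A → Set} where

  -- The walk leaves `t` into `zs` and returns to the old successor `s` of `t`. Nothing but `R t s`
  -- is known about `s`, so the returning edge is supplied as a function of that fact.
  detour : (∀ {x y} → R x y → S x y) →
           ∀ {x y t u v xs zs} → Walk R x y xs → t ∈ xs → t ≢ y →
           S t u → Walk S u v zs → (∀ {s} → R t s → S v s) →
           ∃ λ ys → ys ↭ xs ++ zs × Walk S x y ys
  detour R⇒S {zs = zs} w t∈xs t≢y tu w′ vs
    with as , bs , s , refl , w₁ , r , w₂ ← splitWalk w t∈xs t≢y =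
    as ++ zs ++ bs ,
    ↭-trans (++⁺ˡ as (++-comm zs bs)) (↭-reflexive (sym (++-assoc as bs zs))) ,
    join (weaken R⇒S w₁) tu (join w′ (vs r) (weaken R⇒S w₂))

-- Shifted ranges and adjacency

applyUpTo-+ : ∀ {A : Set} (f : ℕ → A) m n →
              applyUpTo f (m + n) ≡ applyUpTo f m ++ applyUpTo (f ∘ (m +_)) n
applyUpTo-+ f zero    n = refl
applyUpTo-+ f (suc m) n = cong (f 0 ∷_) (applyUpTo-+ (f ∘ suc) m n)

upTo-+ : ∀ m n → upTo (m + n) ≡ upTo m ++ map (m +_) (upTo n)
upTo-+ m n = trans (applyUpTo-+ id m n) (cong (upTo m ++_) (sym (map-upTo (m +_) n)))

module _ {a b : ℕ} where

  adjacent-a : ∀ {x y} → y ≡ x + a → Adjacent a b x y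
  adjacent-a {x} refl = inj₁ (∣m-m+n∣≡n x a)

  adjacent-b : ∀ {x y} → y ≡ x + b → Adjacent a b x y
  adjacent-b {x} refl = inj₂ (∣m-m+n∣≡n x b)

  adjacent-sym : ∀ x y → Adjacent a b x y → Adjacent a b y x
  adjacent-sym x y = subst (λ d → d ≡ a ⊎ d ≡ b) (∣-∣-comm x y)

  adjacent-b⁻ : ∀ {x y} → x ≡ y + b → Adjacent a b x y
  adjacent-b⁻ {x} {y} eq = adjacent-sym y x (adjacent-b eq)

  adjacent-+ : ∀ m {x y} → Adjacent a b x y → Adjacent a b (m + x) (m + y)
  adjacent-+ m {x} {y} = subst (λ d → d ≡ a ⊎ d ≡ b) (sym (∣m+n-m+o∣≡∣n-o∣ m x y))

-- Stacking blocks

module Gluing (a b y : ℕ) (0<a : 0 < a) (y+a<b : y + a < b) where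

  Adj : ℕ → ℕ → Set
  Adj = Adjacent a b

  -- A necklace cut open at the edge `{y , y + a}`. Fixing the same cut for all pieces makes every
  -- junction look alike.
  HamiltonianPath : ℕ → Set
  HamiltonianPath n = ∃ λ xs → xs ↭ upTo n × Walk Adj (y + a) y xs

  -- `glue` accepts any walk `zs` with the shifted endpoints, so that an entire stack can be
  -- inserted at once.
  record Block (m : ℕ) : Set where
    field
      path  : HamiltonianPath m
      glue  : ∀ {zs} → Walk Adj (m + (y + a)) (m + y) zs →
              ∃ λ xs → xs ↭ upTo m ++ zs × Walk Adj (y + a) y xs

  open Block

  attach : ∀ {m n} → Block m → HamiltonianPath n → HamiltonianPath (m + n)
  attach {m} {n} block (zs , zs↭ , w)
    with xs , xs↭ , w′ ← glue block (mapWalk (adjacent-+ m) w) =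
    xs , ↭-trans xs↭ (↭-trans (++⁺ˡ (upTo m) (map⁺ (m +_) zs↭)) (↭-reflexive (sym (upTo-+ m n)))) , w′

  -- A walk is never empty, so there is no path of length 0; the alternative `n ≡ 0` stands for the
  -- empty stack.
  attachAll : ∀ {m} → Block m → ∀ k {n} → n ≡ 0 ⊎ HamiltonianPath n →
              k * m + n ≡ 0 ⊎ HamiltonianPath (k * m + n)
  attachAll block zero    h = h
  attachAll {m} block (suc k) {n} h with attachAll block k {n} h
  ... | inj₂ p  = inj₂ (subst HamiltonianPath (sym (+-assoc m (k * m) n)) (attach block p))
  ... | inj₁ eq = inj₂ (subst HamiltonianPath
                    (trans (sym (+-identityʳ m)) (trans (cong (m +_) (sym eq)) (sym (+-assoc m (k * m) n))))
                    (path block))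

  necklace : ∀ {n} → 3 ≤ n → HamiltonianPath n → Necklace a b n
  necklace 3≤n (xs , xs↭ , w) with ys , refl ← walk-nonempty w = record
    { 3≤n = 3≤n ; first = y + a ; rest = ys ; eachOnce = xs↭
    ; adjacent = walk⇒linked w (adjacent-a {x = y} refl) }

  blocks⇒necklace : ∀ {p q} → Block p → Block q → ∀ j k {n} → n ≡ j * p + k * q → 3 ≤ n → Necklace a b n
  blocks⇒necklace {p} {q} P Q j k refl 3≤n
    with attachAll P j (subst (λ n → n ≡ 0 ⊎ HamiltonianPath n) (+-identityʳ (k * q))
           (attachAll Q k (inj₁ refl)))
  ... | inj₁ eq = contradiction (subst (3 ≤_) eq 3≤n) λ ()
  ... | inj₂ h  = necklace 3≤n h

  -- The upper walk is inserted reversed: it is entered at `m + y`, which is `t + b`, and left from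
  -- `m + y + a`, which is `b` above the old successor `t + a`.
  topEdge⇒block : ∀ {m xs} {R : ℕ → ℕ → Set} → (∀ {p q} → R p q → Adj p q) →
                  xs ↭ upTo m → Walk R (y + a) y xs →
                  ∀ t → t + b ≡ m + y → t ≢ y → (∀ {s} → R t s → s ≡ t + a) → Block m
  topEdge⇒block {m} {xs} {R} R⇒Adj xs↭ w t t+b≡m+y t≢y up = record
    { path = xs , xs↭ , weaken R⇒Adj w
    ; glue = λ {zs} w′ →
        let ys , ys↭ , w″ = detour R⇒Adj w (∈-resp-↭ (↭-sym xs↭) (∈-upTo⁺ t<m)) t≢y
                              (adjacent-b (sym t+b≡m+y)) (reverseWalk (λ {x} {y} → adjacent-sym x y) w′)
                              (adjacent-b⁻ ∘ back ∘ up)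
        in ys , ↭-trans ys↭ (++⁺ xs↭ (↭-reverse zs)) , w″
    }
    where
    t<m : t < m
    t<m = +-cancelʳ-< b t m (subst (_< m + b) (sym t+b≡m+y)
            (+-monoʳ-< m (≤-<-trans (m≤m+n y a) y+a<b)))
    open ≡-Reasoning
    back : ∀ {s} → s ≡ t + a → m + (y + a) ≡ s + b
    back refl = begin
      m + (y + a) ≡⟨ +-assoc m y a ⟨
      m + y + a   ≡⟨ cong (_+ a) t+b≡m+y ⟨
      t + b + a   ≡⟨ +-assoc t b a ⟩
      t + (b + a) ≡⟨ cong (t +_) (+-comm b a) ⟩
      t + (a + b) ≡⟨ +-assoc t a b ⟨
      t + a + b   ∎

  private instance
    a+b≢0 : NonZero (a + b)
    a+b≢0 = >-nonZero (≤-trans 0<a (m≤m+n a b))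

  -- The block of length a + b

  module ResidueWalk (coprime : Coprime a b) where

    Step : ℕ → ℕ → Set
    Step p q = p < a + b × (p < b → q ≡ p + a) × Adj p q

    bead : ℕ → ℕ
    bead = residue (y + a) a (a + b)

    beads-↭ : applyUpTo bead (a + b) ↭ upTo (a + b)
    beads-↭ = residues-↭ (y + a) a (a + b) λ (d∣a+b , d∣a) → coprime (d∣a , ∣m+n∣m⇒∣n d∣a+b d∣a)

    bead-suc : ∀ k → bead (suc k) ≡ (bead k + a) % (a + b)
    bead-suc k = begin
      (y + a + (a + k * a)) % (a + b)  ≡⟨ cong (_% (a + b)) (shuffle (y + a) a (k * a)) ⟩
      (x + a) % (a + b)                ≡⟨ cong (λ z → (z + a) % (a + b)) (m≡m%n+[m/n]*n x (a + b)) ⟩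
      (bead k + q * (a + b) + a) % (a + b) ≡⟨ cong (_% (a + b)) (swapʳ (bead k) (q * (a + b)) a) ⟩
      (bead k + a + q * (a + b)) % (a + b) ≡⟨ [m+kn]%n≡m%n (bead k + a) q (a + b) ⟩
      (bead k + a) % (a + b)           ∎
      where
      open ≡-Reasoning
      x q : ℕ
      x = y + a + k * a
      q = x / (a + b)
      shuffle : ∀ u v w → u + (v + w) ≡ u + w + v
      shuffle = solve-∀
      swapʳ : ∀ u v w → u + v + w ≡ u + w + v
      swapʳ = solve-∀

    -- Adding `a` modulo `a + b` does not wrap around below `b`; from `b` on it wraps around once
    -- and amounts to subtracting `b`.
    bead-step : ∀ k → Step (bead k) (bead (suc k))
    bead-step k = m%n<n _ (a + b) , up , adj
      where
      up : bead k < b → bead (suc k) ≡ bead k + a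
      up p<b = trans (bead-suc k) (m<n⇒m%n≡m (subst (bead k + a <_) (+-comm b a) (+-monoˡ-< a p<b)))
      adj : Adj (bead k) (bead (suc k))
      adj with bead k <? b
      ... | yes p<b = adjacent-a (up p<b)
      ... | no  p≮b with e , b+e≡p ← m≤n⇒∃[o]m+o≡n (≮⇒≥ p≮b) =
        adjacent-b⁻ (begin
          bead k                      ≡⟨ b+e≡p ⟨
          b + e                       ≡⟨ +-comm b e ⟩
          e + b                       ≡⟨ cong (_+ b) (m<n⇒m%n≡m e<a+b) ⟨
          e % (a + b) + b             ≡⟨ cong (_+ b) ([m+n]%n≡m%n e (a + b)) ⟨
          (e + (a + b)) % (a + b) + b ≡⟨ cong (λ z → z % (a + b) + b) (rotate e a b) ⟩
          (b + e + a) % (a + b) + b   ≡⟨ cong (λ z → (z + a) % (a + b) + b) b+e≡p ⟩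
          (bead k + a) % (a + b) + b  ≡⟨ cong (_+ b) (bead-suc k) ⟨
          bead (suc k) + b            ∎)
        where
        open ≡-Reasoning
        rotate : ∀ u v w → u + (v + w) ≡ w + u + v
        rotate = solve-∀
        e<a+b : e < a + b
        e<a+b = ≤-<-trans (m≤n+m e b) (subst (_< a + b) (sym b+e≡p) (m%n<n _ (a + b)))

    bead-first : bead 0 ≡ y + a
    bead-first = trans (cong (_% (a + b)) (+-identityʳ (y + a)))
                   (m<n⇒m%n≡m (<-≤-trans y+a<b (m≤n+m b a)))

    -- The start `y + a` already contributes one `a`, so `a + b - 1` further steps bring the total
    -- to `y + (a + b) * a`.
    bead-last : bead (pred (a + b)) ≡ y
    bead-last = begin
      (y + a + pred (a + b) * a) % (a + b) ≡⟨ cong (_% (a + b)) (+-assoc y a _) ⟩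
      (y + suc (pred (a + b)) * a) % (a + b) ≡⟨ cong (λ n → (y + n * a) % (a + b)) (suc-pred (a + b)) ⟩
      (y + (a + b) * a) % (a + b)          ≡⟨ cong (λ z → (y + z) % (a + b)) (*-comm (a + b) a) ⟩
      (y + a * (a + b)) % (a + b)          ≡⟨ [m+kn]%n≡m%n y a (a + b) ⟩
      y % (a + b)                          ≡⟨ m<n⇒m%n≡m (≤-<-trans (m≤m+n y a) (<-≤-trans y+a<b (m≤n+m b a))) ⟩
      y                                    ∎
      where open ≡-Reasoning

    beadWalk : Walk Step (y + a) y (applyUpTo bead (a + b))
    beadWalk = subst₂ (λ u v → Walk Step u v (applyUpTo bead (a + b))) bead-first bead-last
      (subst (λ n → Walk Step (bead 0) (bead (pred (a + b))) (applyUpTo bead n)) (suc-pred (a + b))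
        (iterateWalk bead bead-step (pred (a + b))))

    -- The top edge leaves the first bead `y + a`, and `y + a < b` keeps that step from wrapping
    -- around.
    [a+b]-block : Block (a + b)
    [a+b]-block = topEdge⇒block (proj₂ ∘ proj₂) beads-↭ beadWalk (y + a) (shuffle y a b)
      (λ eq → m+1+n≢m y (subst (λ z → y + z ≡ y) (sym (suc-pred a {{>-nonZero 0<a}})) eq))
      λ (_ , up , _) → up y+a<b
      where
      shuffle : ∀ u v w → u + v + w ≡ v + w + u
      shuffle = solve-∀

    -- The block of length 3a + b

    module Extension (y<a : y < a) (2a≤b : 2 * a ≤ b) where

      -- The edge {p , p + a} is present after the first j detours: an edge
      -- that has not been replaced yet, or the one added by the first detour.
      Up : ℕ → ℕ → Set
      Up j p = (a + j ≤ p × p < b) ⊎ p ≡ a + b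

      Extended : ℕ → ℕ → ℕ → Set
      Extended j p q = (Up j p → q ≡ p + a) × Adj p q

      -- Each detour lengthens two runs by one vertex, starting at `a + b` and at `a + b + a`. After
      -- `a` detours the first run reaches the second and no gap is left.
      added : ℕ → List ℕ
      added j = map (a + b +_) (upTo j) ++ map (a + b + a +_) (upTo j)

      added-suc : ∀ j → added j ++ (a + b + j ∷ a + b + a + j ∷ []) ↭ added (suc j)
      added-suc j = begin
        (us ++ vs) ++ (u ∷ [ v ]) ≡⟨ ++-assoc us vs _ ⟩
        us ++ vs ++ u ∷ [ v ]     ↭⟨ ++⁺ˡ us (shift u vs [ v ]) ⟩
        us ++ u ∷ (vs ∷ʳ v)       ≡⟨ ++-assoc us [ u ] _ ⟨
        (us ∷ʳ u) ++ (vs ∷ʳ v)    ≡⟨ cong₂ _++_ (map-∷ʳ (a + b +_)) (map-∷ʳ (a + b + a +_)) ⟩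
        added (suc j)             ∎
        where
        open PermutationReasoning
        us vs : List ℕ
        us = map (a + b +_) (upTo j)
        vs = map (a + b + a +_) (upTo j)
        u v : ℕ
        u = a + b + j
        v = a + b + a + j
        map-∷ʳ : ∀ (f : ℕ → ℕ) → map f (upTo j) ∷ʳ f j ≡ map f (upTo (suc j))
        map-∷ʳ f = trans (sym (map-++ f (upTo j) [ j ])) (cong (map f) (upTo-∷ʳ j))

      added-a : upTo (a + b) ++ added a ≡ upTo (3 * a + b)
      added-a = begin
        upTo (a + b) ++ added a
          ≡⟨ cong (λ l → upTo (a + b) ++ map (a + b +_) (upTo a) ++ l)
               (trans (map-cong (+-assoc (a + b) a) (upTo a)) (map-∘ (upTo a))) ⟩
        upTo (a + b) ++ map (a + b +_) (upTo a) ++ map (a + b +_) (map (a +_) (upTo a))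
          ≡⟨ cong (upTo (a + b) ++_) (map-++ (a + b +_) (upTo a) _) ⟨
        upTo (a + b) ++ map (a + b +_) (upTo a ++ map (a +_) (upTo a))
          ≡⟨ cong (λ l → upTo (a + b) ++ map (a + b +_) l) (upTo-+ a a) ⟨
        upTo (a + b) ++ map (a + b +_) (upTo (a + a))
          ≡⟨ upTo-+ (a + b) (a + a) ⟨
        upTo (a + b + (a + a))
          ≡⟨ cong upTo (total a b) ⟩
        upTo (3 * a + b) ∎
        where
        open ≡-Reasoning
        total : ∀ a b → a + b + (a + a) ≡ 3 * a + b
        total = solve-∀

      ExtendedPath : ℕ → Set
      ExtendedPath j = ∃ λ xs → xs ↭ upTo (a + b) ++ added j × Walk (Extended j) (y + a) y xs

      -- `2 * a ≤ b` gives `t < b`, so the step out of `t` still goes to `t + a`; `y < a` keeps `t`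
      -- from being the end of the path.
      extend-suc : ∀ j → j < a → ExtendedPath j → ExtendedPath (suc j)
      extend-suc j j<a (xs , xs↭ , w) =
        let ys , ys↭ , w′ = detour weaker w t∈xs t≢y
                              (¬Up-t , adjacent-b (swapʳ a b j))
                              -- For `j = 0` this step leaves `a + b` and makes the second clause of
                              -- `Up` good.
                              (step ((λ _ → swapʳ (a + b) a j) , adjacent-a (swapʳ (a + b) a j)) done)
                              return
        in ys , (begin
            ys                                ↭⟨ ys↭ ⟩
            xs ++ new                         ↭⟨ ++⁺ʳ new xs↭ ⟩
            (upTo (a + b) ++ added j) ++ new  ≡⟨ ++-assoc (upTo (a + b)) (added j) new ⟩
            upTo (a + b) ++ added j ++ new    ↭⟨ ++⁺ˡ (upTo (a + b)) (added-suc j) ⟩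
            upTo (a + b) ++ added (suc j)     ∎) , w′
        where
        open PermutationReasoning
        t u v : ℕ
        t = a + j
        u = a + b + j
        v = a + b + a + j
        new : List ℕ
        new = u ∷ v ∷ []
        swapʳ : ∀ u v w → u + v + w ≡ u + w + v
        swapʳ = solve-∀
        v≡t+a+b : ∀ a b j → a + b + a + j ≡ a + j + a + b
        v≡t+a+b = solve-∀
        j<b : j < b
        j<b = <-≤-trans j<a (≤-trans (m≤m+n a _) 2a≤b)
        t<b : t < b
        t<b = <-≤-trans (+-monoʳ-< a j<a) (subst (_≤ b) (cong (a +_) (+-identityʳ a)) 2a≤b)
        t∈xs : t ∈ xs
        t∈xs = ∈-resp-↭ (↭-sym xs↭) (∈-++⁺ˡ (∈-upTo⁺ (+-monoʳ-< a j<b)))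
        t≢y : t ≢ y
        t≢y = >⇒≢ (<-≤-trans y<a (m≤m+n a j))
        a+b<v : a + b < v
        a+b<v = <-≤-trans (m<m+n (a + b) 0<a) (m≤m+n (a + b + a) j)
        weaker : ∀ {p q} → Extended j p q → Extended (suc j) p q
        weaker (up , adj) = (λ
          { (inj₁ (a+1+j≤p , p<b)) → up (inj₁ (≤-trans (+-monoʳ-≤ a (n≤1+n j)) a+1+j≤p , p<b))
          ; (inj₂ p≡a+b)           → up (inj₂ p≡a+b) }) , adj
        ¬Up-t : ∀ {q} → Up (suc j) t → q ≡ t + a
        ¬Up-t (inj₁ (a+1+j≤t , _)) = contradiction (+-cancelˡ-≤ a (suc j) j a+1+j≤t) (<-irrefl refl)
        ¬Up-t (inj₂ t≡a+b)         = contradiction (+-cancelˡ-≡ a j b t≡a+b) (<⇒≢ j<b)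
        return : ∀ {s} → Extended j t s → Extended (suc j) v s
        return (up , _) = (λ
          { (inj₁ (_ , v<b)) → contradiction (<-trans (≤-<-trans (m≤n+m b a) a+b<v) v<b) (<-irrefl refl)
          ; (inj₂ v≡a+b)     → contradiction v≡a+b (>⇒≢ a+b<v) }) ,
          adjacent-b⁻ (trans (v≡t+a+b a b j) (cong (_+ b) (sym (up (inj₁ (≤-refl , t<b))))))

      extend : ∀ j → j ≤ a → ExtendedPath j
      extend zero    _   = applyUpTo bead (a + b) , ↭-trans beads-↭ (↭-reflexive (sym (++-identityʳ _))) ,
        weaken (λ (p<a+b , up , adj) →
          -- Before any detour all vertices are below `a + b`, so the second clause of `Up` is
          -- vacuous.
          (λ { (inj₁ (_ , p<b)) → up p<b ; (inj₂ p≡a+b) → contradiction p≡a+b (<⇒≢ p<a+b) }) , adj)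
          beadWalk
      extend (suc j) j<a = extend-suc j j<a (extend j (<⇒≤ j<a))

      -- Gluing needs the edge leaving `3 * a + y`, the vertex `b` below `3 * a + b + y`. Whether
      -- the detours leave such an edge depends on `y`, hence the hypothesis.
      [3a+b]-block : Up a (3 * a + y) → Block (3 * a + b)
      [3a+b]-block top with xs , xs↭ , w ← extend a ≤-refl =
        topEdge⇒block proj₂ (↭-trans xs↭ (↭-reflexive added-a)) w (3 * a + y)
          (swapʳ (3 * a) y b)
          (>⇒≢ (<-≤-trans y<a (≤-trans (m≤m+n a _) (m≤m+n (3 * a) y))))
          λ (up , _) → up top
        where
        swapʳ : ∀ u v w → u + v + w ≡ u + w + v
        swapʳ = solve-∀

-- For b = 3a, that is (a , b) = (1 , 3), no y is such that the extended walk of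
-- length 6 contains both of the edges needed for gluing.
module OneThree where

  open Gluing 1 3 0 (s≤s z≤n) (s≤s (s≤s z≤n))

  path-↭ : 1 ∷ 2 ∷ 5 ∷ 4 ∷ 3 ∷ 0 ∷ [] ↭ upTo 6
  path-↭ = ↭-trans (shift 0 (1 ∷ 2 ∷ 5 ∷ 4 ∷ 3 ∷ []) [])
             (prep 0 (prep 1 (prep 2 (↭-reverse (3 ∷ 4 ∷ 5 ∷ [])))))

  start : Walk Adj 1 4 (1 ∷ 2 ∷ 5 ∷ 4 ∷ [])
  start = step (inj₁ refl) (step (inj₂ refl) (step (inj₁ refl) done))

  end : Walk Adj 3 0 (3 ∷ 0 ∷ [])
  end = step (inj₂ refl) done

  6-block : Block 6
  6-block = record
    { path = _ , path-↭ , join start (inj₁ refl) end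
    -- With `y = 0` the top edge is `{3 , 4}`. This path crosses it downwards, so the upper walk
    -- from 7 to 6 is inserted without reversal.
    ; glue = λ {zs} w → _ ,
        ↭-trans (++⁺ˡ (1 ∷ 2 ∷ 5 ∷ 4 ∷ []) (++-comm zs (3 ∷ 0 ∷ []))) (++⁺ʳ zs path-↭) ,
        join start (inj₂ refl) (join w (inj₂ refl) end)
    }

-- The choice of y

module _ {a b : ℕ} (0<a : 0 < a) (coprime : Coprime a b) (2a≤b : 2 * a ≤ b) where

  representable⇒necklace : ∀ j k {n} → n ≡ j * (a + b) + k * (3 * a + b) → 3 ≤ n → Necklace a b n
  representable⇒necklace with <-cmp (3 * a) b
  -- With `y = 0` the top edge leaves `3 * a`, which lies in the range from `2 * a` up to `b` that
  -- the detours leave alone.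
  ... | tri< 3a<b _ _ = blocks⇒necklace [a+b]-block ([3a+b]-block (inj₁
          ( subst (a + a ≤_) (regroup a) (m≤m+n (a + a) a)
          , subst (_< b) (sym (+-identityʳ (3 * a))) 3a<b)))
    where
    regroup : ∀ a → a + a + a ≡ 3 * a + 0
    regroup = solve-∀
    open Gluing a b 0 0<a (≤-<-trans (m≤m+n a _) 3a<b)
    open ResidueWalk coprime
    open Extension 0<a 2a≤b
  -- With `y = b - 2 * a` the top edge leaves `3 * a + y = a + b`: it is the edge added by the first
  -- detour. Here `b < 3 * a` ensures `y < a`.
  ... | tri> _ _ b<3a with y , refl ← m≤n⇒∃[o]m+o≡n 2a≤b =
          blocks⇒necklace [a+b]-block ([3a+b]-block (inj₂ (+-assoc a (2 * a) y)))
    where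
    open Gluing a (2 * a + y) y 0<a
      (subst (_< 2 * a + y) (+-comm a y) (+-monoˡ-< y (m<m+n a (≤-trans 0<a (m≤m+n a 0)))))
    open ResidueWalk coprime
    open Extension (+-cancelˡ-< (2 * a) y a (subst (2 * a + y <_) (+-comm a (2 * a)) b<3a)) 2a≤b
  -- `a` divides both itself and `b = 3 * a`, so coprimality forces `a = 1`.
  ... | tri≈ _ refl _ with refl ← coprime (∣-refl , n∣m*n 3) =
          blocks⇒necklace [a+b]-block OneThree.6-block
    where
    open Gluing 1 3 0 (s≤s z≤n) (s≤s (s≤s z≤n))
    open ResidueWalk coprime

-- Parity and the bounds on n

odd⇒1+k*2 : ∀ {m} → ¬ 2 ∣ m → ∃ λ k → m ≡ 1 + k * 2
odd⇒1+k*2 {m} 2∤m with m % 2 in eq | m%n<n m 2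
... | 0           | _                 = contradiction (m%n≡0⇒n∣m m 2 eq) 2∤m
... | 1           | _                 = m / 2 , trans (m≡m%n+[m/n]*n m 2) (cong (_+ m / 2 * 2) eq)
... | suc (suc _) | s≤s (s≤s ())

module _ {a b : ℕ} (coprime : Coprime a b) where

  2∣a*b⇒2∤a+b : 2 ∣ a * b → ¬ 2 ∣ a + b
  2∣a*b⇒2∤a+b 2∣ab 2∣a+b with euclidsLemma a b prime[2] 2∣ab
  ... | inj₁ 2∣a = contradiction (coprime (2∣a , ∣m+n∣m⇒∣n 2∣a+b 2∣a)) λ ()
  ... | inj₂ 2∣b = contradiction (coprime (∣m+n∣m⇒∣n (subst (2 ∣_) (+-comm a b) 2∣a+b) 2∣b , 2∣b)) λ ()

  -- A common divisor divides the difference `2 * a`. As `a + b = 1 + k * 2` is odd,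
  -- `a = (a + b) * a - k * (2 * a)` is divisible by it too, and then so is `b`.
  even⇒coprime-lengths : 2 ∣ a * b → Coprime (a + b) (3 * a + b)
  even⇒coprime-lengths 2∣ab {d} (d∣a+b , d∣3a+b) with k , a+b≡1+2k ← odd⇒1+k*2 (2∣a*b⇒2∤a+b 2∣ab) =
    coprime (d∣a , ∣m+n∣m⇒∣n d∣a+b d∣a)
    where
    difference : ∀ a b → 3 * a + b ≡ (a + b) + 2 * a
    difference = solve-∀
    regroup : ∀ k a → (1 + k * 2) * a ≡ k * (2 * a) + a
    regroup = solve-∀
    d∣2a : d ∣ 2 * a
    d∣2a = ∣m+n∣m⇒∣n (subst (d ∣_) (difference a b) d∣3a+b) d∣a+b
    d∣a : d ∣ a
    d∣a = ∣m+n∣m⇒∣n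
      (subst (d ∣_) (trans (cong (_* a) a+b≡1+2k) (regroup k a)) (∣m⇒∣m*n a d∣a+b))
      (∣n⇒∣m*n k d∣2a)

even-case : ∀ {a b} → 0 < a → Coprime a b → 2 * a ≤ b → 2 ∣ a * b →
            ∀ n → (a + b ∸ 1) * (3 * a + b ∸ 1) ≤ n → Necklace a b n
even-case {a} {b} 0<a coprime 2a≤b 2∣ab n large =
  let j , k , n≡ = frobenius (a + b) (3 * a + b) n (even⇒coprime-lengths coprime 2∣ab) large
  in representable⇒necklace 0<a coprime 2a≤b j k n≡
       -- Both factors of the bound are at least 2, so the length is at least 4.
       (≤-trans (≤-trans (n≤1+n 3) (*-mono-≤ 2≤a+b-1 2≤3a+b-1)) large)
  where
  3≤a+b : 3 ≤ a + b
  3≤a+b = +-mono-≤ 0<a (≤-trans (*-monoʳ-≤ 2 0<a) 2a≤b)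
  3≤3a+b : 3 ≤ 3 * a + b
  3≤3a+b = ≤-trans 3≤a+b (+-monoˡ-≤ b (m≤m+n a _))
  2≤a+b-1 : 2 ≤ a + b ∸ 1
  2≤a+b-1 = ∸-monoˡ-≤ 1 3≤a+b
  2≤3a+b-1 : 2 ≤ 3 * a + b ∸ 1
  2≤3a+b-1 = ∸-monoˡ-≤ 1 3≤3a+b
  instance
    a+b≢0 : NonZero (a + b)
    a+b≢0 = >-nonZero (≤-trans (s≤s z≤n) 3≤a+b)
    3a+b≢0 : NonZero (3 * a + b)
    3a+b≢0 = >-nonZero (≤-trans (s≤s z≤n) 3≤3a+b)

-- Everything is halved: `n` is half the length, and `p`, `q` are the halves of `a + b` and
-- `3 * a + b`. They are coprime because `q - p = a` and `2 * p - a = b`, and the stated bound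
-- equals `2 * (p - 1) * (q - 1)`.
odd-case : ∀ i j → Coprime (1 + i * 2) (1 + j * 2) → 2 * (1 + i * 2) ≤ 1 + j * 2 →
           ∀ n → ((1 + i * 2 + (1 + j * 2) ∸ 2) * (3 * (1 + i * 2) + (1 + j * 2) ∸ 2)) / 2 ≤ n * 2 →
           Necklace (1 + i * 2) (1 + j * 2) (n * 2)
-- `b = 1` contradicts `2 * a ≤ b`. A positive `j` makes `p ∸ 1` at least 1 and `q ∸ 1` at least 2,
-- which yields length at least 4.
odd-case i zero      _       2a≤1 = contradiction (≤-trans (*-monoʳ-≤ 2 (s≤s {n = i * 2} z≤n)) 2a≤1) λ { (s≤s ()) }
odd-case i j@(suc _) coprime 2a≤b n large =
  let k , l , n≡ = frobenius p q n coprime-pq bound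
  in representable⇒necklace (s≤s z≤n) coprime 2a≤b k l
       (trans (cong (_* 2) n≡) (trans (expand k l p q)
         (cong₂ (λ u v → k * u + l * v) (sym (a+b≡ i j)) (sym (3a+b≡ i j)))))
       (≤-trans (n≤1+n 3) (*-monoˡ-≤ 2 (≤-trans 2≤[p-1][q-1] bound)))
  where
  p q : ℕ
  p = 1 + (i + j)
  q = 1 + (1 + (3 * i + j))
  a+b≡ : ∀ i j → 1 + i * 2 + (1 + j * 2) ≡ (1 + (i + j)) * 2
  a+b≡ = solve-∀
  3a+b≡ : ∀ i j → 3 * (1 + i * 2) + (1 + j * 2) ≡ (1 + (1 + (3 * i + j))) * 2
  3a+b≡ = solve-∀
  q≡p+a : ∀ i j → 1 + (1 + (3 * i + j)) ≡ 1 + (i + j) + (1 + i * 2)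
  q≡p+a = solve-∀
  expand : ∀ k l p q → (k * p + l * q) * 2 ≡ k * (p * 2) + l * (q * 2)
  expand = solve-∀
  regroup : ∀ x y → x * 2 * (y * 2) ≡ x * y * 2 * 2
  regroup = solve-∀
  coprime-pq : Coprime p q
  coprime-pq {d} (d∣p , d∣q) =
    let d∣a = ∣m+n∣m⇒∣n (subst (d ∣_) (q≡p+a i j) d∣q) d∣p
    in coprime (d∣a , ∣m+n∣m⇒∣n (subst (d ∣_) (sym (a+b≡ i j)) (∣m⇒∣m*n 2 d∣p)) d∣a)
  half : (1 + i * 2 + (1 + j * 2) ∸ 2) * (3 * (1 + i * 2) + (1 + j * 2) ∸ 2) / 2 ≡ (p ∸ 1) * (q ∸ 1) * 2
  half = begin
    (1 + i * 2 + (1 + j * 2) ∸ 2) * (3 * (1 + i * 2) + (1 + j * 2) ∸ 2) / 2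
      ≡⟨ cong₂ (λ u v → (u ∸ 2) * (v ∸ 2) / 2) (a+b≡ i j) (3a+b≡ i j) ⟩
    (p ∸ 1) * 2 * ((q ∸ 1) * 2) / 2  ≡⟨ cong (_/ 2) (regroup (p ∸ 1) (q ∸ 1)) ⟩
    (p ∸ 1) * (q ∸ 1) * 2 * 2 / 2    ≡⟨ m*n/n≡m ((p ∸ 1) * (q ∸ 1) * 2) 2 ⟩
    (p ∸ 1) * (q ∸ 1) * 2            ∎
    where open ≡-Reasoning
  bound : (p ∸ 1) * (q ∸ 1) ≤ n
  bound = *-cancelʳ-≤ _ n 2 (subst (_≤ n * 2) half large)
  2≤[p-1][q-1] : 2 ≤ (p ∸ 1) * (q ∸ 1)
  2≤[p-1][q-1] = *-mono-≤ {1} {p ∸ 1} {2} {q ∸ 1} (≤-trans (s≤s z≤n) (m≤n+m j i))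
                   (s≤s (≤-trans (s≤s z≤n) (m≤n+m j (3 * i))))

theorem2p4 : ∀ (a b : ℕ) → 0 < a → 0 < b → Coprime a b → 2 * a ≤ b →
    (2 ∣ a * b →
    ∀ (n : ℕ) → n ≥ (a + b ∸ 1) * (3 * a + b ∸ 1) → Necklace a b n)
    × (¬ (2 ∣ a * b) →
    ∀ (n : ℕ) → 2 ∣ n → n ≥ ((a + b ∸ 2) * (3 * a + b ∸ 2)) / 2 → Necklace a b n)
theorem2p4 a b 0<a _ coprime 2a≤b = even-case 0<a coprime 2a≤b , odd
  where
  odd : ¬ (2 ∣ a * b) → ∀ n → 2 ∣ n → n ≥ ((a + b ∸ 2) * (3 * a + b ∸ 2)) / 2 → Necklace a b n
  odd 2∤ab n (divides-refl m) large
    with i , refl ← odd⇒1+k*2 {a} (λ 2∣a → 2∤ab (∣m⇒∣m*n b 2∣a))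
       | j , refl ← odd⇒1+k*2 {b} (λ 2∣b → 2∤ab (∣n⇒∣m*n a 2∣b)) =
    odd-case i j coprime 2a≤b m large
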